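{- Let $C$ be a command of a stacks machine with stacks $S_1,\dots,S_{N-1}$, well typed in iSAPP (that is, $\vdash C:\mathbf A$ is derivable for some matrix $\mathbf A$), and let $\sigma_0,\sigma_n$ be states. If $\pi$ is a derivation of $\langle C,\sigma_0\rangle\to_c^{\alpha}\sigma_n$, then there is a polynomial $p$ such that the size $|\pi|$ is bounded by $p\bigl(\sum_{i}|\sigma_0(S_i)|\bigr)$. Here $|w|$ denotes the size (length) of the stack content $w$.
   Context: **Stacks machines.** A stacks machine has a finite alphabet $\Sigma$ containing $\mathsf{true},\mathsf{false}$; finitely many operators $\mathtt{op}:\Sigma^r\to\Sigma$, including a 0-ary operator $\mathtt{rand}$ (those with values in $\{\mathsf{true},\mathsf{false}\}$ are called predicates and written $\mathtt{op?}$); finitely many registers $\mathbf r$ (each holding a letter); finitely many stacks $S_1,\dots,S_{N-1}$ (each holding a finite word over $\Sigma$, written $\langle c_1\ldots c_q\rangle$ with $c_1$ on top; $\langle\rangle$ is the empty stack); and a set of defined functions. Syntax: Booleans $b ::= \mathsf{true}\mid\mathsf{false}\mid \mathtt{op?}(e_1,\dots,e_r)\mid \mathtt{rand}()\mid \mathtt{isempty?}(S)$. Expressions $e ::= c\mid \mathbf r\mid \mathtt{op}(e_1,\dots,e_r)\mid \mathtt{top}(S)$. Commands $C ::= \mathbf{skip}\mid \mathbf r:=e\mid S_i:=S_j\mid S_i:=\langle c_1\ldots c_q\rangle\mid S_i:=\mathbf{call}(f,S_{k_1},\dots,S_{k_m})\mid \mathbf{pop}(S)\mid \mathbf{push}(e,S)\mid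 C;C\mid \mathbf{If}\ b\ \mathbf{Then}\ C\ \mathbf{Else}\ C\mid \mathbf{loop}\ S_k\,\{C\}$, where in $\mathbf{loop}\ S_k\{C\}$ the stack $S_k$ may not appear in $C$. Function definitions: $\mathbf{def}\ f\ \mathbf{in}\ (S_1,\dots,S_m)\{C\}\ \mathbf{out}(S_j)$. **Evaluation.** A state $\sigma$ assigns a word to each stack and a letter to each register. Expressions evaluate without probability label: constants to themselves, $\mathbf r$ to $\sigma(\mathbf r)$, $\mathtt{top}(S)$ to $c_1$ if $\sigma(S)=\langle c_1\ldots c_q\rangle$, operators according to their implementation. Booleans evaluate with a probability label: $\mathtt{rand}()$ evaluates to $\mathsf{true}$ and to $\mathsf{false}$ with label $1/2$ each; $\mathtt{isempty?}(S)$ evaluates with label $1$, to $\mathsf{true}$ if $\sigma(S)=\langle\rangle$ and to $\mathsf{false}$ otherwise; predicates evaluate according to their implementation. **Semantics** $\langle C,\sigma\rangle\to_c^{\alpha}\sigma'$. With label $1$: $\mathbf{skip}$ leaves $\sigma$ unchanged; $\mathbf r:=e$, $S_i:=S_j$, $S_i:=\langle c_1\ldots c_q\rangle$ perform the assignment; if $\sigma(S)=\langle c_1,c_2,\dots,c_q\rangle$, $\mathbf{pop}(S)$ sets $S$ to $\langle c_2,\dots,c_q\rangle$; if $\sigma(S)=\langle c_1,\dots,c_q\rangle$, $\mathbf{push}(e,S)$ sets $S$ to $\langle e,c_1,\dots,c_q\rangle$. If $\langle C_1,\sigma\rangle\to_c^{\alpha}\sigma'$ and $\langle C_2,\sigma'\rangle\to_c^{\beta}\sigma''$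 then $\langle C_1;C_2,\sigma\rangle\to_c^{\alpha\beta}\sigma''$. If $b$ evaluates in $\sigma$ to $\mathsf{true}$ (resp. $\mathsf{false}$) with label $\alpha$ and $\langle C_1,\sigma\rangle\to_c^{\beta}\sigma'$ (resp. $\langle C_2,\sigma\rangle\to_c^{\beta}\sigma'$), then $\langle\mathbf{If}\ b\ \mathbf{Then}\ C_1\ \mathbf{Else}\ C_2,\sigma\rangle\to_c^{\alpha\beta}\sigma'$. If $\sigma(S_k)$ has length $q$ and $\langle C,\sigma_{t-1}\rangle\to_c^{\alpha_t}\sigma_t$ for $t=1,\dots,q$ with $\sigma_0=\sigma$, then $\langle\mathbf{loop}\ S_k\{C\},\sigma\rangle\to_c^{\prod_t\alpha_t}\sigma_q$ (for $q=0$: $\sigma$ with label $1$). Call: if $\mathbf{def}\ f\ \mathbf{in}\ (S_1,\dots,S_m)\{C\}\ \mathbf{out}(S_j)$ is a defined function and $\langle C,\tau\rangle\to_c^{\alpha}\sigma'$, where $\tau$ is $\sigma$ with $S_1,\dots,S_m$ replaced by the actual arguments $S_{k_1},\dots,S_{k_m}$, then $\langle S_i:=\mathbf{call}(f,S_{k_1},\dots,S_{k_m}),\sigma\rangle\to_c^{\alpha}\sigma'$. The size $|\pi|$ of a derivation $\pi$ built with these rules measures the number of execution steps. **Algebra.** $\{0,L,A,M\}$ is ordered by $0<L<A<M$. Union $\cup$ is the maximum. Sum: $0$ is neutral, $L+L=A$, otherwise $x+y=\max(x,y)$. Product: $0$ is absorbing, $L$ is neutral, and $x\times y=\max(x,y)$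 for $x,y\in\{A,M\}$. Matrices are $N\times N$ (the last index $N$ is for constants), with the usual sum and product built from these operations, and entrywise union and order; $\mathbf I$ has $L$ on the diagonal and $0$ elsewhere; $\mathbf V^v_i$ is the column vector with $v$ in row $i$ and $0$ elsewhere; $\mathbf A\xleftarrow{i}V$ is $\mathbf A$ with its $i$-th column replaced by $V$. Union closure: $\mathbf A^{\cup}=\bigcup_{i\ge0}\mathbf A^i$. Merge down $\mathbf A^{\downarrow k}$ ($k<N$): if $V$ is the $j$-th column of $\mathbf A$, the $j$-th column of $\mathbf A^{\downarrow k}$ is $V^{\downarrow k,j}$, defined as follows. For $j=N$: $(V^{\downarrow k,N})_i=V_i$ for all $i$. For $j<N$, row $k$: $(V^{\downarrow k,j})_k$ is $M$ if there is $p<N$, $p\ne k$, with $V_p\ne0$; otherwise it is $0$ if $V_N=0$, $L$ if $V_N=L$, $A$ if $V_N\ge A$ (and $V_k$ in any remaining case). For $j<N$, the other rows $i$: $(V^{\downarrow k,j})_i$ is $0$ if $i=N$; $M$ if $i\ne j$, $V_i\ne0$ and $V_j\ne0$; and $V_i$ otherwise. **Typing rules.** $\mathbf{skip}$, $\mathbf{pop}(S)$, $\mathbf r:=e$ have type $\mathbf I$. $S_i:=\langle c_1\ldots c_q\rangle$ has type $\mathbf I\xleftarrow{i}\mathbf V^A_N$ if $q>1$, $\mathbf I\xleftarrow{i}\mathbf V^L_N$ if $q=1$, $\mathbf I\xleftarrow{i}\mathbf V^0_N$ if $q=0$. $S_i:=S_j$ has type $\mathbf I\xleftarrow{i}\mathbf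 V^L_j$. $\mathbf{push}(e,S_i)$ has type $\mathbf I\xleftarrow{i}(\mathbf V^L_N+\mathbf V^L_i)$. If $C_1:\mathbf A$ and $C_2:\mathbf B$ then $C_1;C_2:\mathbf A\times\mathbf B$ and $\mathbf{If}\ b\ \mathbf{Then}\ C_1\ \mathbf{Else}\ C_2:\mathbf A\cup\mathbf B$. If $C:\mathbf A$ and $(\mathbf A^{\cup})_{i,i}<A$ for all $i$, then $\mathbf{loop}\ S_k\{C\}:(\mathbf A^{\cup})^{\downarrow k}$. If $C:\mathbf A$ and $\mathbf A\le\mathbf B$ then $C:\mathbf B$. If $C:\mathbf A$, then $\mathbf{def}\ f\ \mathbf{in}\ (S_1,\dots,S_m)\{C\}\ \mathbf{out}(S_j)$ has type $\mathbf A$, and then $S_i:=\mathbf{call}(f,S_{k_1},\dots,S_{k_m})$ has type $\mathbf I\xleftarrow{i}U$, where $U$ is the $j$-th column $V$ of $\mathbf A$ with its rows re-ordered by $1\to k_1,\dots,m\to k_m$ (rows not mentioned stay in place), rows landing on the same position being summed: $U_p=\sum_{h\to p}V_h$.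
   Formalization: Two rules are corrected, as the claim fails otherwise: a call assigns the body's output stack to S_i and keeps the caller's other stacks; entry (k,k) of the merge down is V_k, not 0, when V_N and all V_p (p≠k) are 0. The polynomial depends only on the machine and C. -}

module Defs where

open import Data.Bool.Base using (Bool; true; false; if_then_else_)
open import Data.Fin.Base using (Fin; toℕ; fromℕ; fromℕ<; inject₁)
open import Data.Fin.Properties using (_≟_; any?)
open import Data.List.Base using (List; []; _∷_; length)
open import Data.Nat.Base using (ℕ; zero; suc; _+_; _*_; _≤_; _<_)
open import Data.Nat.Properties using (_<?_)
open import Data.Product.Base using (∃; _×_)
open import Data.Rational.Base using (ℚ; 1ℚ; ½) renaming (_*_ to _*ℚ_)
open import Data.Sum.Base using (_⊎_)
open import Data.Unit.Base using (⊤)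
open import Data.Vec.Base as Vec using (Vec; []; _∷_; lookup; tabulate; _[_]≔_)
open import Data.Vec.Functional using (Vector; foldr)
open import Data.Vec.Relation.Unary.All using (All)
open import Relation.Binary.Definitions using (DecidableEquality)
open import Relation.Binary.PropositionalEquality using (_≡_; _≢_; refl)
open import Relation.Nullary.Decidable using (yes; no; ⌊_⌋; ¬?; _×-dec_)

------------------------------------------------------------------------
-- Univariate polynomials with natural coefficients, lowest degree first

Polynomial : Set
Polynomial = List ℕ

evaluate : Polynomial → ℕ → ℕ
evaluate []      x = 0
evaluate (a ∷ p) x = a + x * evaluate p x

------------------------------------------------------------------------
-- The algebra {0 < L < A < M}

data Value : Set where
  𝟎 L A M : Value

rank : Value → ℕ
rank 𝟎 = 0
rank L = 1
rank A = 2
rank M = 3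

infix 4 _≤ᵛ_ _<ᵛ_

_≤ᵛ_ _<ᵛ_ : Value → Value → Set
x ≤ᵛ y = rank x ≤ rank y
x <ᵛ y = rank x < rank y

infix 4 _≟ᵛ_

_≟ᵛ_ : DecidableEquality Value
𝟎 ≟ᵛ 𝟎 = yes refl
𝟎 ≟ᵛ L = no λ ()
𝟎 ≟ᵛ A = no λ ()
𝟎 ≟ᵛ M = no λ ()
L ≟ᵛ 𝟎 = no λ ()
L ≟ᵛ L = yes refl
L ≟ᵛ A = no λ ()
L ≟ᵛ M = no λ ()
A ≟ᵛ 𝟎 = no λ ()
A ≟ᵛ L = no λ ()
A ≟ᵛ A = yes refl
A ≟ᵛ M = no λ ()
M ≟ᵛ 𝟎 = no λ ()
M ≟ᵛ L = no λ ()
M ≟ᵛ A = no λ ()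
M ≟ᵛ M = yes refl

infixl 6 _∪ᵛ_ _+ᵛ_
infixl 7 _×ᵛ_

_∪ᵛ_ : Value → Value → Value
𝟎 ∪ᵛ y = y
L ∪ᵛ 𝟎 = L
L ∪ᵛ L = L
L ∪ᵛ A = A
L ∪ᵛ M = M
A ∪ᵛ 𝟎 = A
A ∪ᵛ L = A
A ∪ᵛ A = A
A ∪ᵛ M = M
M ∪ᵛ y = M

_+ᵛ_ : Value → Value → Value
L +ᵛ L = A
x +ᵛ y = x ∪ᵛ y

_×ᵛ_ : Value → Value → Value
𝟎 ×ᵛ y = 𝟎
L ×ᵛ y = y
A ×ᵛ 𝟎 = 𝟎
A ×ᵛ L = A
A ×ᵛ A = A
A ×ᵛ M = M
M ×ᵛ 𝟎 = 𝟎
M ×ᵛ L = M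
M ×ᵛ A = M
M ×ᵛ M = M

Σᵛ : ∀ {m} → Vector Value m → Value
Σᵛ = foldr _+ᵛ_ 𝟎

------------------------------------------------------------------------
-- Matrices for n stacks: N = suc n, stack i has index inject₁ i, and
-- fromℕ n is the index N of constants.  Entries are written (row, column).

module Matrices (n : ℕ) where

  N : ℕ
  N = suc n

  Column : Set
  Column = Vector Value N

  Matrix : Set
  Matrix = Fin N → Fin N → Value

  stackIx : Fin n → Fin N
  stackIx = inject₁

  constIx : Fin N
  constIx = fromℕ n

  infix 4 _≤ᴹ_
  infixl 6 _∪ᴹ_ _+ᶜ_
  infixl 7 _×ᴹ_

  _≤ᴹ_ : Matrix → Matrix → Set
  P ≤ᴹ Q = ∀ i j → P i j ≤ᵛ Q i j

  _∪ᴹ_ : Matrix → Matrix → Matrix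
  (P ∪ᴹ Q) i j = P i j ∪ᵛ Q i j

  _×ᴹ_ : Matrix → Matrix → Matrix
  (P ×ᴹ Q) i j = Σᵛ λ h → P i h ×ᵛ Q h j

  _+ᶜ_ : Column → Column → Column
  (U +ᶜ V) i = U i +ᵛ V i

  column : Fin N → Matrix → Column
  column j P i = P i j

  𝐕[_,_] : Value → Fin N → Column
  𝐕[ v , i ] h = if ⌊ h ≟ i ⌋ then v else 𝟎

  𝐈 : Matrix
  𝐈 i j = 𝐕[ L , j ] i

  infixl 5 _←[_]_

  _←[_]_ : Matrix → Fin N → Column → Matrix
  (P ←[ i ] V) h j = if ⌊ j ≟ i ⌋ then V h else P h j

  infixr 8 _^ᴹ_

  _^ᴹ_ : Matrix → ℕ → Matrix
  P ^ᴹ zero  = 𝐈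
  P ^ᴹ suc t = P ×ᴹ P ^ᴹ t

  -- Q = ⋃_{t ≥ 0} Pᵗ, i.e. Q is the least upper bound of all the powers.
  record IsUnionClosure (P Q : Matrix) : Set where
    field
      upper : ∀ t → P ^ᴹ t ≤ᴹ Q
      least : ∀ R → (∀ t → P ^ᴹ t ≤ᴹ R) → Q ≤ᴹ R

  -- Row k of V^{↓k,j} (j a stack index).  When every V_p (p < N, p ≠ k) and
  -- V_N are 0, the entry is V_k if j = k, and 0 otherwise.  Taking 0 for
  -- j = k as well would assert that S_k is empty after loop S_k {skip},
  -- and would make
  --   loop S₃ { S₂ := S₁; loop S₂ {push(c,S₁)}; loop S₁ {skip} },
  -- which doubles S₁ at each turn of the outer loop, typable.
  mergeRow : Fin n → Fin N → Column → Value
  mergeRow k j V =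
    if ⌊ any? (λ p → ¬? (p ≟ k) ×-dec ¬? (V (stackIx p) ≟ᵛ 𝟎)) ⌋
    then M
    else byConstant (V constIx)
    where
    byConstant : Value → Value
    byConstant 𝟎 = if ⌊ j ≟ stackIx k ⌋ then V (stackIx k) else 𝟎
    byConstant L = L
    byConstant A = A
    byConstant M = A

  mergeColumn : Fin n → Fin N → Column → Column
  mergeColumn k j V i =
    if ⌊ j ≟ constIx ⌋ then V i
    else if ⌊ i ≟ stackIx k ⌋ then mergeRow k j V
    else if ⌊ i ≟ constIx ⌋ then 𝟎
    else if ⌊ ¬? (i ≟ j) ×-dec ¬? (V i ≟ᵛ 𝟎) ×-dec ¬? (V j ≟ᵛ 𝟎) ⌋ then M
    else V i

  mergeDown : Fin n → Matrix → Matrix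
  mergeDown k P i j = mergeColumn k j (column j P) i

  -- Where row h goes when the formal parameters S₁,…,Sₘ are replaced by the
  -- stacks ks.
  destination : ∀ {m} → Vec (Fin n) m → Fin N → Fin N
  destination {m} ks h with toℕ h <? m
  ... | yes h<m = stackIx (lookup ks (fromℕ< h<m))
  ... | no  _   = h

  reorder : ∀ {m} → Vec (Fin n) m → Column → Column
  reorder ks V p = Σᵛ λ h → if ⌊ destination ks h ≟ p ⌋ then V h else 𝟎

------------------------------------------------------------------------
-- Syntax

-- rand is not listed among the #ops operators: these are the ones that are
-- implemented by a function on letters.
record Signature : Set₁ where
  field
    #letters    : ℕ
    trueᴸ       : Fin #letters
    falseᴸ      : Fin #letters
    true≢false  : trueᴸ ≢ falseᴸ
    #ops        : ℕ
    arity       : Fin #ops → ℕ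
    implement   : (o : Fin #ops) → Vec (Fin #letters) (arity o) → Fin #letters
    #registers  : ℕ
    #stacks     : ℕ
    Function    : Set
    #params     : Function → ℕ
    #params≤    : ∀ f → #params f ≤ #stacks

module Syntax (sig : Signature) where

  open Signature sig public

  Letter Register Stack : Set
  Letter   = Fin #letters
  Register = Fin #registers
  Stack    = Fin #stacks

  data Operator : ℕ → Set where
    fun  : (o : Fin #ops) → Operator (arity o)
    rand : Operator 0

  IsPredicate : Fin #ops → Set
  IsPredicate o = ∀ cs → implement o cs ≡ trueᴸ ⊎ implement o cs ≡ falseᴸ

  data Expr : Set where
    const : Letter → Expr
    reg   : Register → Expr
    op    : ∀ {r} → Operator r → Vec Expr r → Expr
    top   : Stack → Expr

  data BExpr : Set where
    true     : BExpr
    false    : BExpr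
    pred     : (o : Fin #ops) → IsPredicate o → Vec Expr (arity o) → BExpr
    rand     : BExpr
    isempty? : Stack → BExpr

  -- k ∉… means that the stack k does not appear in the phrase.
  mutual
    _∉ᴱ_ : Stack → Expr → Set
    k ∉ᴱ const c = ⊤
    k ∉ᴱ reg r   = ⊤
    k ∉ᴱ op o es = k ∉ᴱˢ es
    k ∉ᴱ top S   = k ≢ S

    _∉ᴱˢ_ : ∀ {r} → Stack → Vec Expr r → Set
    k ∉ᴱˢ []       = ⊤
    k ∉ᴱˢ (e ∷ es) = k ∉ᴱ e × k ∉ᴱˢ es

  _∉ᴮ_ : Stack → BExpr → Set
  k ∉ᴮ true        = ⊤
  k ∉ᴮ false       = ⊤
  k ∉ᴮ pred o _ es = k ∉ᴱˢ es
  k ∉ᴮ rand        = ⊤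
  k ∉ᴮ isempty? S  = k ≢ S

  infixr 5 _⨾_

  mutual
    data Command : Set where
      skip        : Command
      setReg      : Register → Expr → Command
      copy        : (i j : Stack) → Command
      setStack    : Stack → List Letter → Command
      call        : (i : Stack) (f : Function) → Vec Stack (#params f) → Command
      pop         : Stack → Command
      push        : Expr → Stack → Command
      _⨾_         : Command → Command → Command
      If_Then_Else_ : BExpr → Command → Command → Command
      loop        : (k : Stack) (C : Command) → k ∉ C → Command

    _∉_ : Stack → Command → Set
    k ∉ skip                 = ⊤
    k ∉ setReg r e           = k ∉ᴱ e
    k ∉ copy i j             = k ≢ i × k ≢ j
    k ∉ setStack i w         = k ≢ i
    k ∉ call i f ks          = k ≢ i × All (k ≢_) ks
    k ∉ pop S                = k ≢ S
    k ∉ push e S             = k ∉ᴱ e × k ≢ S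
    k ∉ (C₁ ⨾ C₂)            = k ∉ C₁ × k ∉ C₂
    k ∉ (If b Then C₁ Else C₂) = k ∉ᴮ b × k ∉ C₁ × k ∉ C₂
    k ∉ loop k′ C _          = k ≢ k′ × k ∉ C

  -- The formal parameters of f are the stacks of index < #params f.
  record Definition : Set where
    constructor def
    field
      body : Command
      out  : Stack

record Machine : Set₁ where
  field
    signature : Signature
  open Syntax signature public
  field
    definition : Function → Definition

------------------------------------------------------------------------
-- Semantics

module Semantics (𝓜 : Machine) where

  open Machine 𝓜
  open Definition

  record State : Set where
    constructor state
    field
      stacks    : Vec (List Letter) #stacks
      registers : Vec Letter #registers

    stackOf : Stack → List Letter
    stackOf S = lookup stacks S

    regOf : Register → Letter
    regOf r = lookup registers r

  open State

  totalSize : State → ℕ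
  totalSize σ = Vec.sum (Vec.map length (stacks σ))

  setS : State → Stack → List Letter → State
  setS σ S w = record σ { stacks = stacks σ [ S ]≔ w }

  setR : State → Register → Letter → State
  setR σ r c = record σ { registers = registers σ [ r ]≔ c }

  actual : ∀ {m} → Vec Stack m → Stack → Stack
  actual {m} ks h with toℕ h <? m
  ... | yes h<m = lookup ks (fromℕ< h<m)
  ... | no  _   = h

  passArgs : ∀ {m} → Vec Stack m → State → State
  passArgs ks σ = record σ { stacks = tabulate λ h → stackOf σ (actual ks h) }

  -- The result of S_i := call(f,…) in σ, when the body of f ends in σ′: the
  -- output stack is assigned to S_i, the other stacks are those of the caller,
  -- and registers are global.
  return : (i j : Stack) (σ σ′ : State) → State
  return i j σ σ′ = state (stacks σ [ i ]≔ stackOf σ′ j) (registers σ′)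

  data Apply : ∀ {r} → Operator r → Vec Letter r → Letter → Set where
    fun       : ∀ {o cs} → Apply (fun o) cs (implement o cs)
    randTrue  : Apply rand [] trueᴸ
    randFalse : Apply rand [] falseᴸ

  infix 4 _⊢_⇓_ _⊢_⇓ˢ_ _⊢_⇓ᴮ[_]_

  mutual
    data _⊢_⇓_ (σ : State) : Expr → Letter → Set where
      const : ∀ {c} → σ ⊢ const c ⇓ c
      reg   : ∀ {r} → σ ⊢ reg r ⇓ regOf σ r
      top   : ∀ {S c w} → stackOf σ S ≡ c ∷ w → σ ⊢ top S ⇓ c
      op    : ∀ {r} {o : Operator r} {es cs c} →
              σ ⊢ es ⇓ˢ cs → Apply o cs c → σ ⊢ op o es ⇓ c

    data _⊢_⇓ˢ_ (σ : State) : ∀ {r} → Vec Expr r → Vec Letter r → Set where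
      []  : σ ⊢ [] ⇓ˢ []
      _∷_ : ∀ {r e c} {es : Vec Expr r} {cs} →
            σ ⊢ e ⇓ c → σ ⊢ es ⇓ˢ cs → σ ⊢ e ∷ es ⇓ˢ c ∷ cs

  data _⊢_⇓ᴮ[_]_ (σ : State) : BExpr → ℚ → Bool → Set where
    true      : σ ⊢ true ⇓ᴮ[ 1ℚ ] true
    false     : σ ⊢ false ⇓ᴮ[ 1ℚ ] false
    predTrue  : ∀ {o ip es cs} → σ ⊢ es ⇓ˢ cs → implement o cs ≡ trueᴸ →
                σ ⊢ pred o ip es ⇓ᴮ[ 1ℚ ] true
    predFalse : ∀ {o ip es cs} → σ ⊢ es ⇓ˢ cs → implement o cs ≡ falseᴸ →
                σ ⊢ pred o ip es ⇓ᴮ[ 1ℚ ] false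
    randTrue  : σ ⊢ rand ⇓ᴮ[ ½ ] true
    randFalse : σ ⊢ rand ⇓ᴮ[ ½ ] false
    empty     : ∀ {S} → stackOf σ S ≡ [] → σ ⊢ isempty? S ⇓ᴮ[ 1ℚ ] true
    nonempty  : ∀ {S} → stackOf σ S ≢ [] → σ ⊢ isempty? S ⇓ᴮ[ 1ℚ ] false

  infix 4 ⟨_,_⟩⟶[_]_ ⟨_^_,_⟩⟶[_]_

  mutual
    data ⟨_,_⟩⟶[_]_ : Command → State → ℚ → State → Set where
      skip     : ∀ {σ} → ⟨ skip , σ ⟩⟶[ 1ℚ ] σ
      setReg   : ∀ {σ r e c} → σ ⊢ e ⇓ c →
                 ⟨ setReg r e , σ ⟩⟶[ 1ℚ ] setR σ r c
      copy     : ∀ {σ i j} → ⟨ copy i j , σ ⟩⟶[ 1ℚ ] setS σ i (stackOf σ j)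
      setStack : ∀ {σ i w} → ⟨ setStack i w , σ ⟩⟶[ 1ℚ ] setS σ i w
      pop      : ∀ {σ S c w} → stackOf σ S ≡ c ∷ w →
                 ⟨ pop S , σ ⟩⟶[ 1ℚ ] setS σ S w
      push     : ∀ {σ S e c} → σ ⊢ e ⇓ c →
                 ⟨ push e S , σ ⟩⟶[ 1ℚ ] setS σ S (c ∷ stackOf σ S)
      _⨾_      : ∀ {C₁ C₂ σ σ′ σ″ α β} →
                 ⟨ C₁ , σ ⟩⟶[ α ] σ′ → ⟨ C₂ , σ′ ⟩⟶[ β ] σ″ →
                 ⟨ C₁ ⨾ C₂ , σ ⟩⟶[ α *ℚ β ] σ″
      ifTrue   : ∀ {b C₁ C₂ σ σ′ α β} →
                 σ ⊢ b ⇓ᴮ[ α ] true → ⟨ C₁ , σ ⟩⟶[ β ] σ′ →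
                 ⟨ If b Then C₁ Else C₂ , σ ⟩⟶[ α *ℚ β ] σ′
      ifFalse  : ∀ {b C₁ C₂ σ σ′ α β} →
                 σ ⊢ b ⇓ᴮ[ α ] false → ⟨ C₂ , σ ⟩⟶[ β ] σ′ →
                 ⟨ If b Then C₁ Else C₂ , σ ⟩⟶[ α *ℚ β ] σ′
      loop     : ∀ {k C k∉C σ σ′ α} →
                 ⟨ C ^ length (stackOf σ k) , σ ⟩⟶[ α ] σ′ →
                 ⟨ loop k C k∉C , σ ⟩⟶[ α ] σ′
      call     : ∀ {i f ks σ σ′ α} →
                 ⟨ body (definition f) , passArgs ks σ ⟩⟶[ α ] σ′ →
                 ⟨ call i f ks , σ ⟩⟶[ α ] return i (out (definition f)) σ σ′

    -- q successive executions of C: the premises of a single loop rule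
    data ⟨_^_,_⟩⟶[_]_ : Command → ℕ → State → ℚ → State → Set where
      []  : ∀ {C σ} → ⟨ C ^ 0 , σ ⟩⟶[ 1ℚ ] σ
      _∷_ : ∀ {C q σ σ′ σ″ α β} →
            ⟨ C , σ ⟩⟶[ α ] σ′ → ⟨ C ^ q , σ′ ⟩⟶[ β ] σ″ →
            ⟨ C ^ suc q , σ ⟩⟶[ α *ℚ β ] σ″

  -- Sizes count every rule instance of the derivation, those evaluating
  -- expressions and booleans included.
  mutual
    sizeᴱ : ∀ {σ e c} → σ ⊢ e ⇓ c → ℕ
    sizeᴱ const    = 1
    sizeᴱ reg      = 1
    sizeᴱ (top _)  = 1
    sizeᴱ (op d _) = suc (sizeᴱˢ d)

    sizeᴱˢ : ∀ {σ r} {es : Vec Expr r} {cs} → σ ⊢ es ⇓ˢ cs → ℕ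
    sizeᴱˢ []       = 0
    sizeᴱˢ (d ∷ ds) = sizeᴱ d + sizeᴱˢ ds

  sizeᴮ : ∀ {σ b α v} → σ ⊢ b ⇓ᴮ[ α ] v → ℕ
  sizeᴮ true            = 1
  sizeᴮ false           = 1
  sizeᴮ (predTrue d _)  = suc (sizeᴱˢ d)
  sizeᴮ (predFalse d _) = suc (sizeᴱˢ d)
  sizeᴮ randTrue        = 1
  sizeᴮ randFalse       = 1
  sizeᴮ (empty _)       = 1
  sizeᴮ (nonempty _)    = 1

  mutual
    size : ∀ {C σ α σ′} → ⟨ C , σ ⟩⟶[ α ] σ′ → ℕ
    size skip          = 1
    size (setReg d)    = suc (sizeᴱ d)
    size copy          = 1
    size setStack      = 1
    size (pop _)       = 1
    size (push d)      = suc (sizeᴱ d)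
    size (π₁ ⨾ π₂)     = suc (size π₁ + size π₂)
    size (ifTrue d π)  = suc (sizeᴮ d + size π)
    size (ifFalse d π) = suc (sizeᴮ d + size π)
    size (loop πs)     = suc (size* πs)
    size (call π)      = suc (size π)

    size* : ∀ {C q σ α σ′} → ⟨ C ^ q , σ ⟩⟶[ α ] σ′ → ℕ
    size* []       = 0
    size* (π ∷ πs) = size π + size* πs

------------------------------------------------------------------------
-- Typing

module Typing (𝓜 : Machine) where

  open Machine 𝓜
  open Definition
  open Matrices #stacks public

  constantValue : List Letter → Value
  constantValue []          = 𝟎
  constantValue (_ ∷ [])    = L
  constantValue (_ ∷ _ ∷ _) = A

  infix 4 ⊢_∶_ ⊢def_∶_

  mutual
    data ⊢_∶_ : Command → Matrix → Set where
      skip     : ⊢ skip ∶ 𝐈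
      pop      : ∀ {S} → ⊢ pop S ∶ 𝐈
      setReg   : ∀ {r e} → ⊢ setReg r e ∶ 𝐈
      setStack : ∀ {i w} →
                 ⊢ setStack i w ∶ 𝐈 ←[ stackIx i ] 𝐕[ constantValue w , constIx ]
      copy     : ∀ {i j} → ⊢ copy i j ∶ 𝐈 ←[ stackIx i ] 𝐕[ L , stackIx j ]
      push     : ∀ {e i} →
                 ⊢ push e i ∶ 𝐈 ←[ stackIx i ] (𝐕[ L , constIx ] +ᶜ 𝐕[ L , stackIx i ])
      _⨾_      : ∀ {C₁ C₂ P Q} → ⊢ C₁ ∶ P → ⊢ C₂ ∶ Q → ⊢ C₁ ⨾ C₂ ∶ P ×ᴹ Q
      if       : ∀ {b C₁ C₂ P Q} → ⊢ C₁ ∶ P → ⊢ C₂ ∶ Q →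
                 ⊢ If b Then C₁ Else C₂ ∶ P ∪ᴹ Q
      loop     : ∀ {k C k∉C P P∪} → ⊢ C ∶ P → IsUnionClosure P P∪ →
                 (∀ i → P∪ i i <ᵛ A) → ⊢ loop k C k∉C ∶ mergeDown k P∪
      sub      : ∀ {C P Q} → ⊢ C ∶ P → P ≤ᴹ Q → ⊢ C ∶ Q
      call     : ∀ {i f ks P} → ⊢def f ∶ P →
                 ⊢ call i f ks ∶
                   𝐈 ←[ stackIx i ] reorder ks (column (stackIx (out (definition f))) P)

    data ⊢def_∶_ : Function → Matrix → Set where
      def : ∀ {f P} → ⊢ body (definition f) ∶ P → ⊢def f ∶ P

  WellTyped : Command → Set
  WellTyped C = ∃ λ P → ⊢ C ∶ P

{-# OPTIONS --safe #-}
module Submission where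

-- A matrix is read as follows: if m bounds the initial sizes of the stacks
-- with value L in column j, and y bounds those with value A or M, then the
-- final size of stack j is at most m + p(y), for a polynomial p depending only
-- on the command.  This reading is stable under composition and union.  For a
-- loop, consider the graph of the non-zero entries of the union closure.  As
-- its diagonal is below A, inside a strongly connected component all entries
-- are L, so the maximum size over a component grows in each turn by at most a
-- polynomial in the sizes of the stacks strictly below the component; by
-- induction along the order of the components, the sizes stay polynomial
-- during the whole loop.  The number of turns being the size of a stack, the
-- cost of the loop is polynomial too.

open import Defs
open import Data.Bool.Base using (if_then_else_)
open import Data.Fin.Base using (Fin; zero; suc; toℕ)
open import Data.Fin.Induction using (spo-wellFounded)
open import Data.Fin.Properties using (_≟_; any?; inject₁-injective; fromℕ≢inject₁; toℕ-inject₁; fromℕ<-cong)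
open import Data.List.Base using (List; []; _∷_; length; map)
open import Data.Nat.Base using (ℕ; zero; suc; _+_; _*_; _≤_; _<_; z≤n; s≤s)
open import Data.Nat.Properties renaming (_≟_ to _≟ℕ_)
open import Data.Nat.Solver using (module +-*-Solver)
open import Data.Product.Base using (∃; _×_; _,_; proj₁; proj₂)
open import Data.Rational.Base using (ℚ)
open import Data.Sum.Base using (_⊎_; inj₁; inj₂)
open import Data.Unit.Base using (⊤; tt)
open import Data.Vec.Base as Vec using (Vec; []; _∷_; lookup)
open import Data.Vec.Functional using (Vector)
open import Data.Vec.Properties using (lookup∘update; lookup∘update′; lookup∘tabulate)
open import Function.Base using (_∘_)
open import Induction.WellFounded using (Acc; acc)
open import Relation.Binary.PropositionalEquality
open import Relation.Binary.Structures using (IsStrictPartialOrder)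
open import Relation.Nullary using (Dec; yes; no; ¬_; contradiction)
open import Relation.Nullary.Decidable using (⌊_⌋; ¬?; _×-dec_; _→-dec_; _⊎-dec_; from-yes; map′; decidable-stable)

if-yes : {X Y : Set} (d : Dec X) {a b : Y} → X → (if ⌊ d ⌋ then a else b) ≡ a
if-yes (yes _) _ = refl
if-yes (no ¬x) x = contradiction x ¬x

if-no : {X Y : Set} (d : Dec X) {a b : Y} → ¬ X → (if ⌊ d ⌋ then a else b) ≡ b
if-no (yes x) ¬x = contradiction x ¬x
if-no (no _)  _  = refl

-- Polynomials

infixl 6 _⊕_
infixl 7 _⊗_
infixr 9 _∘ᴾ_

_⊕_ : Polynomial → Polynomial → Polynomial
[]      ⊕ q       = q
(a ∷ p) ⊕ []      = a ∷ p
(a ∷ p) ⊕ (b ∷ q) = a + b ∷ p ⊕ q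

scale : ℕ → Polynomial → Polynomial
scale c = map (c *_)

_⊗_ : Polynomial → Polynomial → Polynomial
[]      ⊗ q = []
(a ∷ p) ⊗ q = scale a q ⊕ (0 ∷ p ⊗ q)

constᴾ : ℕ → Polynomial
constᴾ c = c ∷ []

_∘ᴾ_ : Polynomial → Polynomial → Polynomial
[]      ∘ᴾ q = []
(a ∷ p) ∘ᴾ q = constᴾ a ⊕ q ⊗ (p ∘ᴾ q)

X : Polynomial
X = 0 ∷ 1 ∷ []

evaluate-⊕ : ∀ p q x → evaluate (p ⊕ q) x ≡ evaluate p x + evaluate q x
evaluate-⊕ []      q       x = refl
evaluate-⊕ (a ∷ p) []      x = sym (+-identityʳ _)
evaluate-⊕ (a ∷ p) (b ∷ q) x = trans
  (cong (λ z → a + b + x * z) (evaluate-⊕ p q x))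
  (solve 5 (λ a b x u v → a :+ b :+ x :* (u :+ v) := (a :+ x :* u) :+ (b :+ x :* v))
    refl a b x (evaluate p x) (evaluate q x))
  where open +-*-Solver

evaluate-scale : ∀ c p x → evaluate (scale c p) x ≡ c * evaluate p x
evaluate-scale c []      x = sym (*-zeroʳ c)
evaluate-scale c (a ∷ p) x = trans
  (cong (λ z → c * a + x * z) (evaluate-scale c p x))
  (solve 4 (λ c a x u → c :* a :+ x :* (c :* u) := c :* (a :+ x :* u))
    refl c a x (evaluate p x))
  where open +-*-Solver

evaluate-⊗ : ∀ p q x → evaluate (p ⊗ q) x ≡ evaluate p x * evaluate q x
evaluate-⊗ []      q x = refl
evaluate-⊗ (a ∷ p) q x = trans
  (trans (evaluate-⊕ (scale a q) (0 ∷ p ⊗ q) x)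
    (cong₂ (λ u v → u + x * v) (evaluate-scale a q x) (evaluate-⊗ p q x)))
  (solve 4 (λ a x u v → a :* v :+ x :* (u :* v) := (a :+ x :* u) :* v)
    refl a x (evaluate p x) (evaluate q x))
  where open +-*-Solver

evaluate-const : ∀ c x → evaluate (constᴾ c) x ≡ c
evaluate-const c x = trans (cong (c +_) (*-zeroʳ x)) (+-identityʳ c)

evaluate-∘ : ∀ p q x → evaluate (p ∘ᴾ q) x ≡ evaluate p (evaluate q x)
evaluate-∘ []      q x = refl
evaluate-∘ (a ∷ p) q x = trans (evaluate-⊕ (constᴾ a) (q ⊗ (p ∘ᴾ q)) x)
  (cong₂ _+_ (evaluate-const a x)
    (trans (evaluate-⊗ q (p ∘ᴾ q) x) (cong (evaluate q x *_) (evaluate-∘ p q x))))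

evaluate-X : ∀ x → evaluate X x ≡ x
evaluate-X x = trans (cong (x *_) (evaluate-const 1 x)) (*-identityʳ x)

infix 4 _≼_

_≼_ : Polynomial → Polynomial → Set
p ≼ q = ∀ x → evaluate p x ≤ evaluate q x

p≼p⊕q : ∀ p q → p ≼ p ⊕ q
p≼p⊕q p q x = ≤-trans (m≤m+n _ _) (≤-reflexive (sym (evaluate-⊕ p q x)))

q≼p⊕q : ∀ p q → q ≼ p ⊕ q
q≼p⊕q p q x = ≤-trans (m≤n+m _ _) (≤-reflexive (sym (evaluate-⊕ p q x)))

-- The sum of the individual witnesses dominates each of them. Restricting to a decidable `D` allows
-- use inside an induction, where bounds exist only for the indices already treated.
common-bound : ∀ {n} {D : Fin n → Set} (R : Fin n → Polynomial → Set) →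
               (∀ i {p q} → p ≼ q → R i p → R i q) →
               (∀ i → Dec (D i)) → (∀ i → D i → ∃ (R i)) →
               ∃ λ p → ∀ i → D i → R i p
common-bound {zero}  R weaken D? bound = [] , λ ()
common-bound {suc n} R weaken D? bound
  with common-bound (R ∘ suc) (weaken ∘ suc) (D? ∘ suc) (bound ∘ suc) | D? zero
... | p , bounded | no ¬d = p , λ where
  zero    d → contradiction d ¬d
  (suc i) d → bounded i d
... | p , bounded | yes d₀ = let (p₀ , bounded₀) = bound zero d₀ in p₀ ⊕ p , λ where
  zero    _ → weaken zero (p≼p⊕q p₀ p) bounded₀
  (suc i) d → weaken (suc i) (q≼p⊕q p₀ p) (bounded i d)

-- Values

-- With only four values, quantified statements are decidable, so the laws below are proved by
-- evaluating the decision.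
∀ᵛ? : {R : Value → Set} → (∀ v → Dec (R v)) → Dec (∀ v → R v)
∀ᵛ? R? = map′
  (λ (r₀ , r₁ , r₂ , r₃) → λ { 𝟎 → r₀ ; L → r₁ ; A → r₂ ; M → r₃ })
  (λ r → r 𝟎 , r L , r A , r M)
  (R? 𝟎 ×-dec R? L ×-dec R? A ×-dec R? M)

infix 4 _≤ᵛ?_

_≤ᵛ?_ : ∀ x y → Dec (x ≤ᵛ y)
x ≤ᵛ? y = rank x ≤? rank y

x≤x+y : ∀ x y → x ≤ᵛ x +ᵛ y
x≤x+y = from-yes (∀ᵛ? λ x → ∀ᵛ? λ y → x ≤ᵛ? x +ᵛ y)

y≤x+y : ∀ x y → y ≤ᵛ x +ᵛ y
y≤x+y = from-yes (∀ᵛ? λ x → ∀ᵛ? λ y → y ≤ᵛ? x +ᵛ y)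

x≤x∪y : ∀ x y → x ≤ᵛ x ∪ᵛ y
x≤x∪y = from-yes (∀ᵛ? λ x → ∀ᵛ? λ y → x ≤ᵛ? x ∪ᵛ y)

y≤x∪y : ∀ x y → y ≤ᵛ x ∪ᵛ y
y≤x∪y = from-yes (∀ᵛ? λ x → ∀ᵛ? λ y → y ≤ᵛ? x ∪ᵛ y)

+-support : ∀ x y → L ≤ᵛ x +ᵛ y → L ≤ᵛ x ⊎ L ≤ᵛ y
+-support = from-yes (∀ᵛ? λ x → ∀ᵛ? λ y → (L ≤ᵛ? x +ᵛ y) →-dec ((L ≤ᵛ? x) ⊎-dec (L ≤ᵛ? y)))

×-support : ∀ x y → L ≤ᵛ x ×ᵛ y → L ≤ᵛ x × L ≤ᵛ y
×-support = from-yes (∀ᵛ? λ x → ∀ᵛ? λ y → (L ≤ᵛ? x ×ᵛ y) →-dec ((L ≤ᵛ? x) ×-dec (L ≤ᵛ? y)))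

x≤x×y : ∀ x y → L ≤ᵛ y → x ≤ᵛ x ×ᵛ y
x≤x×y = from-yes (∀ᵛ? λ x → ∀ᵛ? λ y → (L ≤ᵛ? y) →-dec (x ≤ᵛ? x ×ᵛ y))

y≤x×y : ∀ x y → L ≤ᵛ x → y ≤ᵛ x ×ᵛ y
y≤x×y = from-yes (∀ᵛ? λ x → ∀ᵛ? λ y → (L ≤ᵛ? x) →-dec (y ≤ᵛ? x ×ᵛ y))

L≤⇒≢𝟎 : ∀ {x} → L ≤ᵛ x → x ≢ 𝟎
L≤⇒≢𝟎 () refl

rank-injective : ∀ x y → rank x ≡ rank y → x ≡ y
rank-injective = from-yes (∀ᵛ? λ x → ∀ᵛ? λ y → (rank x ≟ℕ rank y) →-dec (x ≟ᵛ y))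

predᵛ : Value → Value
predᵛ 𝟎 = 𝟎
predᵛ L = 𝟎
predᵛ A = L
predᵛ M = A

<⇒≤predᵛ : ∀ x y → x <ᵛ y → x ≤ᵛ predᵛ y
<⇒≤predᵛ = from-yes (∀ᵛ? λ x → ∀ᵛ? λ y → (rank x <? rank y) →-dec (x ≤ᵛ? predᵛ y))

<⇒≰predᵛ : ∀ x y → x <ᵛ y → ¬ y ≤ᵛ predᵛ y
<⇒≰predᵛ = from-yes (∀ᵛ? λ x → ∀ᵛ? λ y → (rank x <? rank y) →-dec ¬? (y ≤ᵛ? predᵛ y))

term≤Σᵛ : ∀ {m} (f : Vector Value m) i → f i ≤ᵛ Σᵛ f
term≤Σᵛ f zero    = x≤x+y (f zero) _
term≤Σᵛ f (suc i) = ≤-trans (term≤Σᵛ (f ∘ suc) i) (y≤x+y (f zero) _)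

Σᵛ-support : ∀ {m} (f : Vector Value m) → L ≤ᵛ Σᵛ f → ∃ λ i → L ≤ᵛ f i
Σᵛ-support {suc m} f L≤Σ with +-support (f zero) _ L≤Σ
... | inj₁ L≤f₀ = zero , L≤f₀
... | inj₂ L≤Σ′ = let (i , L≤fᵢ) = Σᵛ-support (f ∘ suc) L≤Σ′ in suc i , L≤fᵢ

-- m bounds the quantities that enter linearly (value L), y those that enter
-- polynomially.  A quantity bounded by y may also be used linearly, whence
-- m + y: this makes Fits antitone in the value.
Fits : Value → (m y x : ℕ) → Set
Fits v m y x = (L ≤ᵛ v → x ≤ m + y) × (A ≤ᵛ v → x ≤ y)

fits-antitone : ∀ {u v m y x} → u ≤ᵛ v → Fits v m y x → Fits u m y x
fits-antitone u≤v (lin , pol) = (λ p → lin (≤-trans p u≤v)) , (λ p → pol (≤-trans p u≤v))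

fits-≤ : ∀ {m y x} v → x ≤ y → Fits v m y x
fits-≤ {m} v x≤y = (λ _ → ≤-trans x≤y (m≤n+m _ m)) , (λ _ → x≤y)

-- Matrices as bounds on sizes

module Bounds (n : ℕ) where

  open Matrices n

  -- The meaning of a matrix: x are the sizes of the stacks before the
  -- execution, x′ those after it.  The row of constants is ignored, as
  -- constants are absorbed by the polynomial.
  Bound : Polynomial → Matrix → (x x′ : Fin n → ℕ) → Set
  Bound p P x x′ = ∀ j m y → (∀ i → Fits (P (stackIx i) (stackIx j)) m y (x i)) →
                   x′ j ≤ m + evaluate p y

  bound-mono : ∀ p q P Q {x x′} → p ≼ q → P ≤ᴹ Q → Bound p P x x′ → Bound q Q x x′
  bound-mono p q P Q p≼q P≤Q b j m y fits =
    ≤-trans (b j m y λ i → fits-antitone (P≤Q _ _) (fits i)) (+-monoʳ-≤ m (p≼q y))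

  bound-≤ : ∀ p P {x x′ y} → Bound p P x x′ → (∀ i → x i ≤ y) → ∀ j → x′ j ≤ evaluate p y
  bound-≤ p P b x≤y j = b j 0 _ λ i → fits-≤ _ (x≤y i)

  -- The intermediate sizes fit `Q` with the same `m` and with `evaluate p y` in place of `y`; each
  -- term of the sum defining the product lies below it.
  bound-∘ : ∀ p q P Q {x x′ x″} → Bound p P x x′ → Bound q Q x′ x″ →
            Bound (q ∘ᴾ p) (P ×ᴹ Q) x x″
  bound-∘ p q P Q {x} {x′} {x″} bp bq j m y fits =
    subst (λ z → x″ j ≤ m + z) (sym (evaluate-∘ q p y)) (bq j m (evaluate p y) fits′)
    where
    term : ∀ i h → P (stackIx i) h ×ᵛ Q h (stackIx j) ≤ᵛ (P ×ᴹ Q) (stackIx i) (stackIx j)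
    term i h = term≤Σᵛ (λ h → P (stackIx i) h ×ᵛ Q h (stackIx j)) h

    fits′ : ∀ h → Fits (Q (stackIx h) (stackIx j)) m (evaluate p y) (x′ h)
    fits′ h =
      (λ L≤Q → bp h m y λ i →
        fits-antitone (≤-trans (x≤x×y _ _ L≤Q) (term i (stackIx h))) (fits i)) ,
      -- Here every nonzero entry of `P` into `h` gives a product of at least `A`, so its source is
      -- bounded by `y` and `m` can be zero.
      (λ A≤Q → bp h 0 y λ i →
        let small = λ L≤P → proj₂ (fits i)
                      (≤-trans (≤-trans A≤Q (y≤x×y _ _ L≤P)) (term i (stackIx h)))
        in small , small ∘ ≤-trans (s≤s z≤n))

  𝐕-self : ∀ v i → 𝐕[ v , i ] i ≡ v
  𝐕-self v i = if-yes (i ≟ i) refl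

  bound-𝐈 : ∀ {x x′} → (∀ i → x′ i ≤ x i) → Bound X 𝐈 x x′
  bound-𝐈 {x} {x′} x′≤x j m y fits = ≤-trans (x′≤x j)
    (subst (λ z → x j ≤ m + z) (sym (evaluate-X y))
      (proj₁ (fits j) (≤-reflexive (cong rank (sym (𝐕-self L (stackIx j)))))))

  bound-← : ∀ {p x x′} i V → (∀ j → j ≢ i → x′ j ≡ x j) →
            (∀ m y → (∀ h → Fits (V (stackIx h)) m y (x h)) → x′ i ≤ m + evaluate p y) →
            Bound (X ⊕ p) (𝐈 ←[ stackIx i ] V) x x′
  bound-← {p} {x} {x′} i V same new j m y fits with j ≟ i
  ... | yes refl = ≤-trans
    (new m y λ h → fits-antitone
      (≤-reflexive (cong rank (sym (if-yes (stackIx i ≟ stackIx i) refl)))) (fits h))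
    (+-monoʳ-≤ m (q≼p⊕q X p y))
  ... | no j≢i = subst (_≤ m + evaluate (X ⊕ p) y) (sym (same j j≢i)) (≤-trans
    (bound-𝐈 {x} {x} (λ _ → ≤-refl) j m y λ h → fits-antitone
      (≤-reflexive (cong rank (sym (if-no (stackIx j ≟ stackIx i) (j≢i ∘ inject₁-injective)))))
      (fits h))
    (+-monoʳ-≤ m (p≼p⊕q X p y)))

  -- Loops

  -- The loop stack survives its own loop, so its dependence on itself must not be erased. If all
  -- other entries of the column vanish, this rests on the default being `V (stackIx k)`.
  mergeRow-loop-stack : ∀ k V → L ≤ᵛ V (stackIx k) → L ≤ᵛ mergeRow k (stackIx k) V
  mergeRow-loop-stack k V L≤Vₖ
    with any? (λ p → ¬? (p ≟ k) ×-dec ¬? (V (stackIx p) ≟ᵛ 𝟎)) | V constIx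
  ... | yes _ | _ = s≤s z≤n
  ... | no _  | 𝟎 = subst (L ≤ᵛ_) (sym (if-yes (stackIx k ≟ stackIx k) refl)) L≤Vₖ
  ... | no _  | L = s≤s z≤n
  ... | no _  | A = s≤s z≤n
  ... | no _  | M = s≤s z≤n

  stackIx≢constIx : ∀ {j} → stackIx j ≢ constIx
  stackIx≢constIx = fromℕ≢inject₁ ∘ sym

  mergeDown-diagonal : ∀ k Q j → L ≤ᵛ Q (stackIx j) (stackIx j) →
                       L ≤ᵛ mergeDown k Q (stackIx j) (stackIx j)
  mergeDown-diagonal k Q j L≤Qⱼⱼ =
    subst (L ≤ᵛ_) (sym (if-no (stackIx j ≟ constIx) stackIx≢constIx)) (rows (j ≟ k))
    where
    rows : Dec (j ≡ k) → L ≤ᵛ _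
    rows (yes refl) = subst (L ≤ᵛ_) (sym (if-yes (stackIx k ≟ stackIx k) refl))
      (mergeRow-loop-stack k (column (stackIx k) Q) L≤Qⱼⱼ)
    rows (no j≢k) = subst (L ≤ᵛ_)
      (sym (trans (if-no (stackIx j ≟ stackIx k) (j≢k ∘ inject₁-injective))
           (trans (if-no (stackIx j ≟ constIx) stackIx≢constIx)
                  (if-no (¬? (stackIx j ≟ stackIx j) ×-dec
                          ¬? (Q (stackIx j) (stackIx j) ≟ᵛ 𝟎) ×-dec
                          ¬? (Q (stackIx j) (stackIx j) ≟ᵛ 𝟎)) λ (j≢j , _) → j≢j refl))))
      L≤Qⱼⱼ

  -- In row `k`, the nonzero diagonal entry at `j` triggers `M`; in any other row, the nonzero
  -- entries at `i` and `j` do. So the number of turns and every other stack feeding `j` may enter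
  -- polynomially.
  mergeDown-offDiagonal : ∀ k Q {i j} → j ≢ k → i ≢ j → L ≤ᵛ Q (stackIx j) (stackIx j) →
                          i ≡ k ⊎ L ≤ᵛ Q (stackIx i) (stackIx j) →
                          mergeDown k Q (stackIx i) (stackIx j) ≡ M
  mergeDown-offDiagonal k Q {i} {j} j≢k i≢j L≤Qⱼⱼ reason =
    trans (if-no (stackIx j ≟ constIx) stackIx≢constIx) (rows (i ≟ k) reason)
    where
    rows : Dec (i ≡ k) → i ≡ k ⊎ L ≤ᵛ Q (stackIx i) (stackIx j) → _ ≡ M
    rows (yes refl) _ = trans (if-yes (stackIx k ≟ stackIx k) refl)
      (if-yes (any? _) (j , j≢k , L≤⇒≢𝟎 L≤Qⱼⱼ))
    rows (no i≢k) (inj₁ i≡k) = contradiction i≡k i≢k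
    rows (no i≢k) (inj₂ L≤Qᵢⱼ) =
      trans (if-no (stackIx i ≟ stackIx k) (i≢k ∘ inject₁-injective))
      (trans (if-no (stackIx i ≟ constIx) stackIx≢constIx)
      (if-yes (¬? (stackIx i ≟ stackIx j) ×-dec
               ¬? (Q (stackIx i) (stackIx j) ≟ᵛ 𝟎) ×-dec
               ¬? (Q (stackIx j) (stackIx j) ≟ᵛ 𝟎))
        (i≢j ∘ inject₁-injective , L≤⇒≢𝟎 L≤Qᵢⱼ , L≤⇒≢𝟎 L≤Qⱼⱼ)))

  -- The union closure as a transitive relation

  module Closure {P Q : Matrix} (closure : IsUnionClosure P Q) where

    open IsUnionClosure closure

    -- Up to double negation, each entry of Q is attained by some power of P:
    -- otherwise that entry could be lowered.
    closure-entry : (Φ : Value → Set) → (∀ v → Dec (Φ v)) → ∀ h j →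
                    (∀ t → Φ ((P ^ᴹ t) h j)) → Φ (Q h j)
    closure-entry Φ Φ? h j φ = decidable-stable (Φ? (Q h j)) λ ¬φ →
      <⇒≰predᵛ _ _ (below ¬φ 0)
        (≤-trans (least lowered (upper′ ¬φ) h j)
          (≤-reflexive (cong rank (if-yes ((h ≟ h) ×-dec (j ≟ j)) (refl , refl)))))
      where
      lowered : Matrix
      lowered a b = if ⌊ (a ≟ h) ×-dec (b ≟ j) ⌋ then predᵛ (Q h j) else Q a b

      below : ¬ Φ (Q h j) → ∀ t → (P ^ᴹ t) h j <ᵛ Q h j
      below ¬φ t = ≤∧≢⇒< (upper t h j)
        λ eq → ¬φ (subst Φ (rank-injective _ _ eq) (φ t))

      upper′ : ¬ Φ (Q h j) → ∀ t → P ^ᴹ t ≤ᴹ lowered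
      upper′ ¬φ t a b with (a ≟ h) ×-dec (b ≟ j)
      ... | yes (refl , refl) = <⇒≤predᵛ _ _ (below ¬φ t)
      ... | no _              = upper t a b

    closure-diagonal : ∀ i → L ≤ᵛ Q i i
    closure-diagonal i =
      ≤-trans (≤-reflexive (cong rank (sym (𝐕-self L i)))) (upper 0 i i)

    -- Only the termwise form of P × Q ≤ Q holds: in the sum, entries
    -- attained by different powers would add up.
    closure-step : ∀ i h j → P i h ×ᵛ Q h j ≤ᵛ Q i j
    closure-step i h j =
      closure-entry (λ v → P i h ×ᵛ v ≤ᵛ Q i j) (λ v → P i h ×ᵛ v ≤ᵛ? Q i j) h j
        λ t → ≤-trans (term≤Σᵛ (λ g → P i g ×ᵛ (P ^ᴹ t) g j) h) (upper (suc t) i j)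

    closure-edge : ∀ i j → P i j ≤ᵛ Q i j
    closure-edge i j = ≤-trans (x≤x×y _ _ (closure-diagonal j)) (closure-step i j j)

    -- The factors `P` of the power are peeled off and absorbed into `Q` one by one through
    -- `closure-step`.
    power-trans : ∀ t i h j → L ≤ᵛ (P ^ᴹ t) i h → L ≤ᵛ Q h j → L ≤ᵛ Q i j
    power-trans zero i h j L≤𝐈 L≤Q with i ≟ h
    ... | yes refl = L≤Q
    power-trans zero i h j () L≤Q | no _
    power-trans (suc t) i h j L≤Pᵗ L≤Q =
      let (g , L≤term)  = Σᵛ-support (λ g → P i g ×ᵛ (P ^ᴹ t) g h) L≤Pᵗ
          (L≤P , L≤Pᵗ′) = ×-support _ _ L≤term
      in ≤-trans (≤-trans L≤P (x≤x×y _ _ (power-trans t g h j L≤Pᵗ′ L≤Q)))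
                 (closure-step i g j)

    closure-trans : ∀ i h j → L ≤ᵛ Q i h → L ≤ᵛ Q h j → L ≤ᵛ Q i j
    closure-trans i h j L≤Qᵢₕ L≤Qₕⱼ =
      closure-entry (λ v → L ≤ᵛ v → L ≤ᵛ Q i j) (λ v → (L ≤ᵛ? v) →-dec (L ≤ᵛ? Q i j)) i h
        (λ t L≤Pᵗ → power-trans t i h j L≤Pᵗ L≤Qₕⱼ) L≤Qᵢₕ

    -- Growth of sizes under iterated steps

    module Iteration {S : Set} (sizes : S → Fin n → ℕ) (Step : S → S → Set)
                     (p : Polynomial)
                     (bound : ∀ {σ σ′} → Step σ σ′ → Bound p P (sizes σ) (sizes σ′))
                     (diagonal : ∀ i → Q i i <ᵛ A) where

      -- Steps are added at the end, because the growth estimate deduces the sizes after the last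
      -- step from those before it.
      data Steps : ℕ → S → S → Set where
        []   : ∀ {σ} → Steps 0 σ σ
        _∷ʳ_ : ∀ {t σ σ′ σ″} → Steps t σ σ′ → Step σ′ σ″ → Steps (suc t) σ σ″

      infix 4 _⇝_ _⊏_ _⇝?_ _⊏?_

      -- The reachability preorder and its strict part; mutually reachable stacks form a strongly
      -- connected component.
      _⇝_ _⊏_ : Fin n → Fin n → Set
      i ⇝ j = L ≤ᵛ Q (stackIx i) (stackIx j)
      i ⊏ j = i ⇝ j × ¬ j ⇝ i

      _⇝?_ : ∀ i j → Dec (i ⇝ j)
      i ⇝? j = L ≤ᵛ? Q (stackIx i) (stackIx j)

      _⊏?_ : ∀ i j → Dec (i ⊏ j)
      i ⊏? j = (i ⇝? j) ×-dec ¬? (j ⇝? i)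

      ⇝-trans : ∀ {i h j} → i ⇝ h → h ⇝ j → i ⇝ j
      ⇝-trans = closure-trans _ _ _

      ⊏-isStrictPartialOrder : IsStrictPartialOrder _≡_ _⊏_
      ⊏-isStrictPartialOrder = record
        { isEquivalence = isEquivalence
        ; irrefl        = λ { refl (i⇝i , ¬i⇝i) → ¬i⇝i i⇝i }
        ; trans         = λ (i⇝h , ¬h⇝i) (h⇝j , _) →
                            ⇝-trans i⇝h h⇝j , λ j⇝i → ¬h⇝i (⇝-trans h⇝j j⇝i)
        ; <-resp-≈      = resp₂ _⊏_
        }

      -- The analogue of `Bound` for many steps: the component of `j` enters linearly, the stacks
      -- strictly below it polynomially. The number of steps is charged to `y` as well.
      Growth : Fin n → Polynomial → Set
      Growth j g = ∀ {t σ σ′} → Steps t σ σ′ → ∀ m y → t ≤ y →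
                   (∀ i → i ⇝ j → sizes σ i ≤ m + y) → (∀ i → i ⊏ j → sizes σ i ≤ y) →
                   sizes σ′ j ≤ m + evaluate g y

      growth-weaken : ∀ j {g g′} → g ≼ g′ → Growth j g → Growth j g′
      growth-weaken j g≼g′ grow s m y t≤y lin pol =
        ≤-trans (grow s m y t≤y lin pol) (+-monoʳ-≤ m (g≼g′ y))

      -- Inside the strongly connected component of j all edges have value L,
      -- an edge of value ≥ A on a cycle being excluded by the diagonal of Q.
      -- So the maximum over the component grows by at most p(G(y)) in each
      -- step, where G bounds the stacks strictly below the component.
      growth-step : ∀ j G → (∀ i → i ⊏ j → Growth i G) → Growth j (X ⊕ X ⊗ (p ∘ᴾ G))
      growth-step j G below {t} {σ} {σ′} s m y t≤y lin pol =
        subst (λ z → sizes σ′ j ≤ m + z) (sym value)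
          (≤-trans (component s t≤y j (closure-diagonal _) (closure-diagonal _))
            (≤-trans (≤-reflexive (+-assoc m y _))
              (+-monoʳ-≤ m (+-monoʳ-≤ y (*-monoˡ-≤ D t≤y)))))
        where
        D : ℕ
        D = evaluate p (evaluate G y)

        value : evaluate (X ⊕ X ⊗ (p ∘ᴾ G)) y ≡ y + y * D
        value = trans (evaluate-⊕ X (X ⊗ (p ∘ᴾ G)) y)
          (cong₂ _+_ (evaluate-X y)
            (trans (evaluate-⊗ X (p ∘ᴾ G) y) (cong₂ _*_ (evaluate-X y) (evaluate-∘ p G y))))

        -- Whatever reaches a stack strictly below `j` is itself strictly below `j`, hence bounded
        -- by `y`, so `m` can be zero.
        lower : ∀ {t σ′} → Steps t σ σ′ → t ≤ y → ∀ i → i ⊏ j → sizes σ′ i ≤ evaluate G y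
        lower s t≤y i i⊏j = below i i⊏j s 0 y t≤y
          (λ h h⇝i → pol h (⇝-trans h⇝i (proj₁ i⊏j) , λ j⇝h → proj₂ i⊏j (⇝-trans j⇝h h⇝i)))
          (λ h h⊏i → pol h (⇝-trans (proj₁ h⊏i) (proj₁ i⊏j) ,
                            λ j⇝h → proj₂ i⊏j (⇝-trans j⇝h (proj₁ h⊏i))))

        component : ∀ {t σ′} → Steps t σ σ′ → t ≤ y → ∀ h → h ⇝ j → j ⇝ h →
                    sizes σ′ h ≤ m + y + t * D
        component [] _ h h⇝j _ = ≤-trans (lin h h⇝j) (≤-reflexive (sym (+-identityʳ _)))
        component {suc t} (_∷ʳ_ {σ′ = σ₁} s step) t<y h h⇝j j⇝h = ≤-trans
          (bound step h (m + y + t * D) (evaluate G y) fits)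
          (≤-reflexive (trans (+-assoc (m + y) (t * D) D) (cong (m + y +_) (+-comm (t * D) D))))
          where
          fits : ∀ i → Fits (P (stackIx i) (stackIx h)) (m + y + t * D) (evaluate G y) (sizes σ₁ i)
          fits i with i ⇝? j | j ⇝? i
          ... | yes i⇝j | no ¬j⇝i = fits-≤ _ (lower s (<⇒≤ t<y) i (i⇝j , ¬j⇝i))
          ... | yes i⇝j | yes j⇝i =
            (λ _ → ≤-trans (component s (<⇒≤ t<y) i i⇝j j⇝i) (m≤m+n _ _)) ,
            -- Such an edge, closed up by the path from `h` back to `i`, would put a value of at
            -- least `A` on the diagonal of `Q`.
            (λ A≤P → contradiction
              (≤-trans A≤P (≤-trans (x≤x×y _ _ (⇝-trans h⇝j j⇝i)) (closure-step _ (stackIx h) _)))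
              (<⇒≱ (diagonal (stackIx i))))
          -- A stack that does not reach `j` has a zero entry into `h`, so nothing is required of
          -- it.
          ... | no ¬i⇝j | _ =
            (λ L≤P → contradiction (edge L≤P) ¬i⇝j) ,
            (λ A≤P → contradiction (edge (≤-trans (s≤s z≤n) A≤P)) ¬i⇝j)
            where
            edge : L ≤ᵛ P (stackIx i) (stackIx h) → i ⇝ j
            edge L≤P = ⇝-trans (≤-trans L≤P (closure-edge _ _)) h⇝j

      growth : ∀ j → ∃ (Growth j)
      growth j = go j (spo-wellFounded ⊏-isStrictPartialOrder j)
        where
        go : ∀ j → Acc _⊏_ j → ∃ (Growth j)
        go j (acc rs) =
          let (G , below) = common-bound Growth growth-weaken (_⊏? j) (λ i i⊏j → go i (rs i⊏j))
          in X ⊕ X ⊗ (p ∘ᴾ G) , growth-step j G below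

      uniform-growth : ∃ λ g → ∀ j → Growth j g
      uniform-growth =
        let (g , grow) = common-bound {D = λ _ → ⊤} Growth growth-weaken (λ _ → yes tt) (λ j _ → growth j)
        in g , λ j → grow j tt

-- Commands

module Soundness (𝓜 : Machine) where

  open Machine 𝓜
  open Definition
  open Semantics 𝓜
  open State
  open Typing 𝓜
  open Bounds #stacks

  sizes : State → Stack → ℕ
  sizes σ S = length (stackOf σ S)

  lookup≤totalSize : ∀ {m} (ws : Vec (List Letter) m) i →
                     length (lookup ws i) ≤ Vec.sum (Vec.map length ws)
  lookup≤totalSize (w ∷ ws) zero    = m≤m+n _ _
  lookup≤totalSize (w ∷ ws) (suc i) = ≤-trans (lookup≤totalSize ws i) (m≤n+m _ _)

  -- Sizes of evaluation derivations

  mutual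
    weightᴱ : Expr → ℕ
    weightᴱ (const c) = 1
    weightᴱ (reg r)   = 1
    weightᴱ (op o es) = suc (weightᴱˢ es)
    weightᴱ (top S)   = 1

    weightᴱˢ : ∀ {r} → Vec Expr r → ℕ
    weightᴱˢ []       = 0
    weightᴱˢ (e ∷ es) = weightᴱ e + weightᴱˢ es

  mutual
    -- Evaluation rules follow the syntax, so the size depends neither on the state nor on the
    -- outcome of `rand`.
    sizeᴱ≡weight : ∀ {σ e c} (d : σ ⊢ e ⇓ c) → sizeᴱ d ≡ weightᴱ e
    sizeᴱ≡weight const    = refl
    sizeᴱ≡weight reg      = refl
    sizeᴱ≡weight (top _)  = refl
    sizeᴱ≡weight (op d _) = cong suc (sizeᴱˢ≡weight d)

    sizeᴱˢ≡weight : ∀ {σ r} {es : Vec Expr r} {cs} (d : σ ⊢ es ⇓ˢ cs) → sizeᴱˢ d ≡ weightᴱˢ es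
    sizeᴱˢ≡weight []       = refl
    sizeᴱˢ≡weight (d ∷ ds) = cong₂ _+_ (sizeᴱ≡weight d) (sizeᴱˢ≡weight ds)

  weightᴮ : BExpr → ℕ
  weightᴮ (pred o _ es) = suc (weightᴱˢ es)
  weightᴮ _             = 1

  sizeᴮ≡weight : ∀ {σ b α v} (d : σ ⊢ b ⇓ᴮ[ α ] v) → sizeᴮ d ≡ weightᴮ b
  sizeᴮ≡weight true            = refl
  sizeᴮ≡weight false           = refl
  sizeᴮ≡weight (predTrue d _)  = cong suc (sizeᴱˢ≡weight d)
  sizeᴮ≡weight (predFalse d _) = cong suc (sizeᴱˢ≡weight d)
  sizeᴮ≡weight randTrue        = refl
  sizeᴮ≡weight randFalse       = refl
  sizeᴮ≡weight (empty _)       = refl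
  sizeᴮ≡weight (nonempty _)    = refl

  sizes-update : ∀ σ i w → sizes (setS σ i w) i ≡ length w
  sizes-update σ i w = cong length (lookup∘update i (stacks σ) w)

  sizes-update′ : ∀ σ i w j → j ≢ i → sizes (setS σ i w) j ≡ sizes σ j
  sizes-update′ σ i w j j≢i = cong length (lookup∘update′ j≢i (stacks σ) w)

  mutual
    unused-unchanged : ∀ {k C σ σ′ α} → k ∉ C → ⟨ C , σ ⟩⟶[ α ] σ′ → sizes σ′ k ≡ sizes σ k
    unused-unchanged k∉ skip                      = refl
    unused-unchanged k∉ (setReg _)                = refl
    unused-unchanged (k≢i , _) (copy {σ})         = sizes-update′ σ _ _ _ k≢i
    unused-unchanged k≢i (setStack {σ})           = sizes-update′ σ _ _ _ k≢i
    unused-unchanged k≢S (pop {σ} _)              = sizes-update′ σ _ _ _ k≢S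
    unused-unchanged (_ , k≢S) (push {σ} _)       = sizes-update′ σ _ _ _ k≢S
    unused-unchanged (k∉₁ , k∉₂) (π₁ ⨾ π₂) =
      trans (unused-unchanged k∉₂ π₂) (unused-unchanged k∉₁ π₁)
    unused-unchanged (_ , k∉₁ , _) (ifTrue _ π)   = unused-unchanged k∉₁ π
    unused-unchanged (_ , _ , k∉₂) (ifFalse _ π)  = unused-unchanged k∉₂ π
    unused-unchanged (_ , k∉) (loop πs)           = unused-unchanged* k∉ πs
    -- The body of the function may alter stack `k`, but on return only stack `i` of the caller is
    -- overwritten.
    unused-unchanged (k≢i , _) (call {σ = σ} π)   = sizes-update′ σ _ _ _ k≢i

    unused-unchanged* : ∀ {k C q σ σ′ α} → k ∉ C → ⟨ C ^ q , σ ⟩⟶[ α ] σ′ →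
                        sizes σ′ k ≡ sizes σ k
    unused-unchanged* k∉ []       = refl
    unused-unchanged* k∉ (π ∷ πs) = trans (unused-unchanged* k∉ πs) (unused-unchanged k∉ π)

  -- Both polynomials are fixed before the states and the derivation, so they serve all random
  -- outcomes. Costs of compositions and loops need `growth`, as later commands run on sizes already
  -- grown.
  record Sound (C : Command) (P : Matrix) : Set where
    field
      growth  : Polynomial
      cost    : Polynomial
      bounded : ∀ {σ σ′ α} → ⟨ C , σ ⟩⟶[ α ] σ′ → Bound growth P (sizes σ) (sizes σ′)
      cheap   : ∀ {σ σ′ α} (π : ⟨ C , σ ⟩⟶[ α ] σ′) y → (∀ i → sizes σ i ≤ y) →
                size π ≤ evaluate cost y

  open Sound

  ≤const : ∀ {a} c y → a ≤ c → a ≤ evaluate (constᴾ c) y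
  ≤const c y a≤c = ≤-trans a≤c (≤-reflexive (sym (evaluate-const c y)))

  ≤suc⊕ : ∀ {a b} p q y → a ≤ evaluate p y → b ≤ evaluate q y →
          suc (a + b) ≤ evaluate (constᴾ 1 ⊕ (p ⊕ q)) y
  ≤suc⊕ p q y a≤p b≤q = ≤-trans (s≤s (+-mono-≤ a≤p b≤q)) (≤-reflexive (sym
    (trans (evaluate-⊕ (constᴾ 1) (p ⊕ q) y)
      (cong₂ _+_ (evaluate-const 1 y) (evaluate-⊕ p q y)))))

  sound-skip : Sound skip 𝐈
  sound-skip .growth         = X
  sound-skip .cost           = constᴾ 1
  sound-skip .bounded skip   = bound-𝐈 λ _ → ≤-refl
  sound-skip .cheap skip y _ = ≤const 1 y ≤-refl

  sound-setReg : ∀ {r e} → Sound (setReg r e) 𝐈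
  sound-setReg         .growth             = X
  sound-setReg {e = e} .cost               = constᴾ (suc (weightᴱ e))
  sound-setReg         .bounded (setReg _) = bound-𝐈 λ _ → ≤-refl
  sound-setReg {e = e} .cheap (setReg d) y _ =
    ≤const (suc (weightᴱ e)) y (s≤s (≤-reflexive (sizeᴱ≡weight d)))

  sound-pop : ∀ {S} → Sound (pop S) 𝐈
  sound-pop .growth          = X
  sound-pop .cost            = constᴾ 1
  sound-pop {S} .bounded {σ} (pop {w = w} eq) = bound-𝐈 shrink
    where
    shrink : ∀ i → sizes (setS σ S w) i ≤ sizes σ i
    shrink i with i ≟ S
    ... | yes refl = ≤-trans (≤-reflexive (sizes-update σ S w))
                       (≤-trans (n≤1+n _) (≤-reflexive (sym (cong length eq))))
    ... | no i≢S   = ≤-reflexive (sizes-update′ σ S w i i≢S)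
  sound-pop .cheap (pop _) y _ = ≤const 1 y ≤-refl

  bound-assign : ∀ {p σ} i w V →
                 (∀ m y → (∀ h → Fits (V (stackIx h)) m y (sizes σ h)) →
                  length w ≤ m + evaluate p y) →
                 Bound (X ⊕ p) (𝐈 ←[ stackIx i ] V) (sizes σ) (sizes (setS σ i w))
  bound-assign {p} {σ} i w V new = bound-← {p} i V (sizes-update′ σ i w) λ m y fits →
    ≤-trans (≤-reflexive (sizes-update σ i w)) (new m y fits)

  sound-setStack : ∀ {i w} →
                   Sound (setStack i w) (𝐈 ←[ stackIx i ] 𝐕[ constantValue w , constIx ])
  sound-setStack {w = w} .growth = X ⊕ constᴾ (length w)
  sound-setStack .cost           = constᴾ 1
  sound-setStack {i} {w} .bounded {σ} setStack =
    bound-assign {constᴾ (length w)} {σ} i w 𝐕[ constantValue w , constIx ] λ m y _ →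
      ≤-trans (≤const (length w) y ≤-refl) (m≤n+m _ m)
  sound-setStack .cheap setStack y _ = ≤const 1 y ≤-refl

  sound-copy : ∀ {i j} → Sound (copy i j) (𝐈 ←[ stackIx i ] 𝐕[ L , stackIx j ])
  sound-copy .growth = X ⊕ X
  sound-copy .cost   = constᴾ 1
  sound-copy {i} {j} .bounded {σ} copy =
    bound-assign {X} {σ} i (stackOf σ j) 𝐕[ L , stackIx j ] λ m y fits →
      subst (λ z → sizes σ j ≤ m + z) (sym (evaluate-X y))
        (proj₁ (fits j) (≤-reflexive (cong rank (sym (𝐕-self L (stackIx j))))))
  sound-copy .cheap copy y _ = ≤const 1 y ≤-refl

  sound-push : ∀ {e i} →
               Sound (push e i) (𝐈 ←[ stackIx i ] (𝐕[ L , constIx ] +ᶜ 𝐕[ L , stackIx i ]))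
  -- In the second summand, `1 + X`, the constant term pays for the pushed letter.
  sound-push     .growth = X ⊕ (1 ∷ 1 ∷ [])
  sound-push {e} .cost   = constᴾ (suc (weightᴱ e))
  sound-push {e} {i} .bounded {σ} (push {c = c} _) =
    bound-assign {1 ∷ 1 ∷ []} {σ} i (c ∷ stackOf σ i) (𝐕[ L , constIx ] +ᶜ 𝐕[ L , stackIx i ])
      λ m y fits → ≤-trans
        (s≤s (proj₁ (fits i) (≤-trans
          (≤-reflexive (cong rank (sym (𝐕-self L (stackIx i)))))
          (y≤x+y (𝐕[ L , constIx ] (stackIx i)) _))))
        (≤-reflexive (trans (sym (+-suc m y)) (cong (λ z → m + suc z) (sym (evaluate-X y)))))
  sound-push {e} .cheap (push d) y _ =
    ≤const (suc (weightᴱ e)) y (s≤s (≤-reflexive (sizeᴱ≡weight d)))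

  sound-⨾ : ∀ {C₁ C₂ P Q} → Sound C₁ P → Sound C₂ Q → Sound (C₁ ⨾ C₂) (P ×ᴹ Q)
  sound-⨾ s₁ s₂ .growth = s₂ .growth ∘ᴾ s₁ .growth
  sound-⨾ s₁ s₂ .cost   = constᴾ 1 ⊕ (s₁ .cost ⊕ s₂ .cost ∘ᴾ s₁ .growth)
  sound-⨾ {P = P} {Q} s₁ s₂ .bounded (π₁ ⨾ π₂) =
    bound-∘ (s₁ .growth) (s₂ .growth) P Q (s₁ .bounded π₁) (s₂ .bounded π₂)
  sound-⨾ {P = P} s₁ s₂ .cheap (π₁ ⨾ π₂) y σ≤y =
    ≤suc⊕ (s₁ .cost) (s₂ .cost ∘ᴾ s₁ .growth) y (s₁ .cheap π₁ y σ≤y)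
      (≤-trans (s₂ .cheap π₂ _ (bound-≤ (s₁ .growth) P (s₁ .bounded π₁) σ≤y))
        (≤-reflexive (sym (evaluate-∘ (s₂ .cost) (s₁ .growth) y))))

  sound-if : ∀ {b C₁ C₂ P Q} → Sound C₁ P → Sound C₂ Q → Sound (If b Then C₁ Else C₂) (P ∪ᴹ Q)
  sound-if s₁ s₂ .growth = s₁ .growth ⊕ s₂ .growth
  sound-if {b} s₁ s₂ .cost = constᴾ 1 ⊕ (constᴾ (weightᴮ b) ⊕ (s₁ .cost ⊕ s₂ .cost))
  sound-if {P = P} {Q} s₁ s₂ .bounded (ifTrue _ π) =
    bound-mono (s₁ .growth) (s₁ .growth ⊕ s₂ .growth) P (P ∪ᴹ Q)
      (p≼p⊕q (s₁ .growth) (s₂ .growth)) (λ i j → x≤x∪y (P i j) (Q i j)) (s₁ .bounded π)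
  sound-if {P = P} {Q} s₁ s₂ .bounded (ifFalse _ π) =
    bound-mono (s₂ .growth) (s₁ .growth ⊕ s₂ .growth) Q (P ∪ᴹ Q)
      (q≼p⊕q (s₁ .growth) (s₂ .growth)) (λ i j → y≤x∪y (P i j) (Q i j)) (s₂ .bounded π)
  sound-if {b} s₁ s₂ .cheap (ifTrue d π) y σ≤y =
    ≤suc⊕ (constᴾ (weightᴮ b)) (s₁ .cost ⊕ s₂ .cost) y
      (≤const (weightᴮ b) y (≤-reflexive (sizeᴮ≡weight d)))
      (≤-trans (s₁ .cheap π y σ≤y) (p≼p⊕q (s₁ .cost) _ y))
  sound-if {b} s₁ s₂ .cheap (ifFalse d π) y σ≤y =
    ≤suc⊕ (constᴾ (weightᴮ b)) (s₁ .cost ⊕ s₂ .cost) y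
      (≤const (weightᴮ b) y (≤-reflexive (sizeᴮ≡weight d)))
      (≤-trans (s₂ .cheap π y σ≤y) (q≼p⊕q (s₁ .cost) _ y))

  sound-sub : ∀ {C P Q} → Sound C P → P ≤ᴹ Q → Sound C Q
  sound-sub s P≤Q .growth    = s .growth
  sound-sub s P≤Q .cost      = s .cost
  sound-sub {P = P} {Q} s P≤Q .bounded π =
    bound-mono (s .growth) (s .growth) P Q (λ _ → ≤-refl) P≤Q (s .bounded π)
  sound-sub s P≤Q .cheap     = s .cheap

  -- Soundness of calls

  destination-stackIx : ∀ {m} (ks : Vec Stack m) h →
                        destination ks (stackIx h) ≡ stackIx (actual ks h)
  destination-stackIx {m} ks h with toℕ (stackIx h) <? m | toℕ h <? m
  ... | yes p | yes q = cong (stackIx ∘ lookup ks) (fromℕ<-cong _ _ (toℕ-inject₁ h) p q)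
  ... | yes p | no ¬q = contradiction (subst (_< m) (toℕ-inject₁ h) p) ¬q
  ... | no ¬p | yes q = contradiction (subst (_< m) (sym (toℕ-inject₁ h)) q) ¬p
  ... | no _  | no _  = refl

  -- Row `h` is one of the summands collected at its actual stack, even if several parameters
  -- receive the same stack.
  ≤reorder : ∀ {m} (ks : Vec Stack m) V h → V (stackIx h) ≤ᵛ reorder ks V (stackIx (actual ks h))
  ≤reorder ks V h = ≤-trans
    (≤-reflexive (cong rank (sym
      (if-yes (destination ks (stackIx h) ≟ stackIx (actual ks h)) (destination-stackIx ks h)))))
    (term≤Σᵛ (λ g → if ⌊ destination ks g ≟ stackIx (actual ks h) ⌋ then V g else 𝟎) (stackIx h))

  sizes-passArgs : ∀ {m} (ks : Vec Stack m) σ h → sizes (passArgs ks σ) h ≡ sizes σ (actual ks h)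
  sizes-passArgs ks σ h = cong length (lookup∘tabulate (stackOf σ ∘ actual ks) h)

  sound-call : ∀ {i f ks P} → Sound (body (definition f)) P →
               Sound (call i f ks)
                 (𝐈 ←[ stackIx i ] reorder ks (column (stackIx (out (definition f))) P))
  sound-call s .growth = X ⊕ s .growth
  sound-call s .cost   = constᴾ 1 ⊕ ([] ⊕ s .cost)
  sound-call {i} {f} {ks} {P} s .bounded {σ} (call {σ′ = σ′} π) =
    bound-assign {s .growth} {σ} i (stackOf σ′ j) (reorder ks V) λ m y fits →
      s .bounded π j m y λ h →
        subst (Fits (V (stackIx h)) m y) (sym (sizes-passArgs ks σ h))
          (fits-antitone (≤reorder ks V h) (fits (actual ks h)))
    where
    j = out (definition f)
    V = column (stackIx j) P
  sound-call {ks = ks} s .cheap {σ} (call π) y σ≤y =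
    ≤suc⊕ [] (s .cost) y z≤n (s .cheap π y λ h →
      subst (_≤ y) (sym (sizes-passArgs ks σ h)) (σ≤y (actual ks h)))

  -- Soundness of loops

  module _ {k : Stack} {C : Command} {k∉C : k ∉ C} {P Q : Matrix} (s : Sound C P) (closure : IsUnionClosure P Q)
           (diagonal : ∀ i → Q i i <ᵛ A) where

    open Closure closure
    open Iteration sizes (λ σ σ′ → ∃ λ α → ⟨ C , σ ⟩⟶[ α ] σ′) (s .growth)
                   (λ (_ , π) → s .bounded π) diagonal
      using (Steps; []; _∷ʳ_; uniform-growth)

    extend : ∀ {t q σ σ′ σ″ α} → Steps t σ σ′ → ⟨ C ^ q , σ′ ⟩⟶[ α ] σ″ → Steps (t + q) σ σ″
    extend {t} s [] = subst (λ z → Steps z _ _) (sym (+-identityʳ t)) s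
    extend {t} {σ = σ} {σ″ = σ″} s (_∷_ {q = q} π πs) =
      subst (λ z → Steps z σ σ″) (sym (+-suc t q)) (extend (s ∷ʳ (_ , π)) πs)

    -- The turns already made are carried along, so that each turn is seen to start at most `y`
    -- steps after `σ`, where `c` bounds its cost.
    iteration-cost : ∀ {t q σ σ′ σ″ α} y c → Steps t σ σ′ → t + q ≤ y →
      (∀ {t σ₁ σ₂ β} → Steps t σ σ₁ → t ≤ y → (π : ⟨ C , σ₁ ⟩⟶[ β ] σ₂) → size π ≤ c) →
      (πs : ⟨ C ^ q , σ′ ⟩⟶[ α ] σ″) → size* πs ≤ q * c
    iteration-cost y c s t+q≤y body≤c [] = z≤n
    iteration-cost {t} y c s t+q≤y body≤c (_∷_ {q = q} π πs) =
      +-mono-≤ (body≤c s (≤-trans (m≤m+n t _) t+q≤y) π)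
        (iteration-cost y c (s ∷ʳ (_ , π)) (≤-trans (≤-reflexive (sym (+-suc t q))) t+q≤y) body≤c πs)

    sound-loop : Sound (loop k C k∉C) (mergeDown k Q)
    -- The first summand bounds the stacks other than `k`, the second the unchanged stack `k`.
    sound-loop .growth = proj₁ uniform-growth ⊕ X
    sound-loop .cost   = constᴾ 1 ⊕ ([] ⊕ X ⊗ (s .cost ∘ᴾ proj₁ uniform-growth))
    sound-loop .bounded {σ} {σ′} (loop πs) j m y fits with j ≟ k
    ... | yes refl = ≤-trans
      (≤-reflexive (unused-unchanged* k∉C πs))
      (≤-trans (proj₁ (fits k) (mergeDown-diagonal k Q k (closure-diagonal _)))
        (+-monoʳ-≤ m (≤-trans (≤-reflexive (sym (evaluate-X y)))
                              (q≼p⊕q (proj₁ uniform-growth) X y))))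
    ... | no j≢k = ≤-trans
      -- The number of turns is the size of stack `k`, whose entry is `M`; hence it is at most `y`.
      (proj₂ uniform-growth j (extend [] πs) m y (small k (j≢k ∘ sym) (inj₁ refl)) linear
        λ i (i⇝j , ¬j⇝i) → small i (λ { refl → ¬j⇝i i⇝j }) (inj₂ i⇝j))
      (+-monoʳ-≤ m (p≼p⊕q (proj₁ uniform-growth) X y))
      where
      small : ∀ i → i ≢ j → i ≡ k ⊎ L ≤ᵛ Q (stackIx i) (stackIx j) → sizes σ i ≤ y
      small i i≢j reason = proj₂ (fits i) (subst (A ≤ᵛ_)
        (sym (mergeDown-offDiagonal k Q j≢k i≢j (closure-diagonal _) reason)) (s≤s (s≤s z≤n)))

      -- Of the stacks reaching `j`, only `j` itself can have an entry other than `M`; the others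
      -- are at most `y`.
      linear : ∀ i → L ≤ᵛ Q (stackIx i) (stackIx j) → sizes σ i ≤ m + y
      linear i L≤Q with i ≟ j
      ... | yes refl = proj₁ (fits i) (mergeDown-diagonal k Q i (closure-diagonal _))
      ... | no i≢j   = ≤-trans (small i i≢j (inj₂ L≤Q)) (m≤n+m y m)
    sound-loop .cheap {σ} (loop πs) y σ≤y =
      ≤suc⊕ [] (X ⊗ (s .cost ∘ᴾ g)) y z≤n (≤-trans
        (iteration-cost y c [] (σ≤y k) body≤c πs)
        (≤-trans (*-monoˡ-≤ c (σ≤y k)) (≤-reflexive (sym
          (trans (evaluate-⊗ X (s .cost ∘ᴾ g) y)
            (cong₂ _*_ (evaluate-X y) (evaluate-∘ (s .cost) g y)))))))
      where
      g = proj₁ uniform-growth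
      c = evaluate (s .cost) (evaluate g y)

      body≤c : ∀ {t σ₁ σ₂ β} → Steps t σ σ₁ → t ≤ y → (π : ⟨ C , σ₁ ⟩⟶[ β ] σ₂) → size π ≤ c
      body≤c steps t≤y π = s .cheap π (evaluate g y) λ i →
        proj₂ uniform-growth i steps 0 y t≤y (λ h _ → σ≤y h) (λ h _ → σ≤y h)

  -- A typing derivation contains a typing of the body of every function called, so the induction
  -- passes through calls; recursive functions have no finite derivation.
  sound : ∀ {C P} → ⊢ C ∶ P → Sound C P
  sound skip              = sound-skip
  sound pop               = sound-pop
  sound setReg            = sound-setReg
  sound setStack          = sound-setStack
  sound copy              = sound-copy
  sound push              = sound-push
  sound (d₁ ⨾ d₂)         = sound-⨾ (sound d₁) (sound d₂)
  sound (if d₁ d₂)        = sound-if (sound d₁) (sound d₂)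
  sound (loop d clo diag) = sound-loop (sound d) clo diag
  sound (sub d P≤Q)       = sound-sub (sound d) P≤Q
  sound (call (def d))    = sound-call (sound d)

theorem17 : (𝓜 : Machine) →
    let open Machine 𝓜
        open Semantics 𝓜
        open Typing 𝓜
    in
    (C : Command) → WellTyped C →
    ∃ λ (p : Polynomial) →
      (σ₀ σₙ : State) (α : ℚ) (π : ⟨ C , σ₀ ⟩⟶[ α ] σₙ) →
      size π ≤ evaluate p (totalSize σ₀)
theorem17 𝓜 C (P , d) = cost s , λ σ₀ σₙ α π →
  cheap s π (totalSize σ₀) (lookup≤totalSize (State.stacks σ₀))
  where
  open Soundness 𝓜
  open Semantics 𝓜
  open Sound
  s = sound d
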